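{- For any deterministic oblivious algorithm $\mathcal{A}$ finding spanning forests, and any numbers $n$ and $m$ with $m=\mathcal{O}(n^2)$, there exists a connected simple graph $G_\mathcal{A}$ with $n$ vertices and $\Theta(m)$ edges such that $\mathcal{A}$ requires time $\Omega(m)$ to find a spanning tree of $G_\mathcal{A}$. (The constants implicit in $\mathcal{O},\Theta,\Omega$ do not depend on $\mathcal{A}$, $n$, $m$.)
   Context: Model: the input is a simple graph $G$ (no weights) on vertex set $\{1,\dots,n\}$; each of its edges is held by exactly one station, each station holds one edge, stations have distinct IDs, and $n$ is known to all stations. Computation is synchronous. In each step every station broadcasts or not; if exactly one station broadcasts its message (its edge) is heard by all; if none, silence is heard; if two or more, a collision signal is heard. An edge is revealed when it is heard; the algorithm finds a spanning forest (here a spanning tree, as the graph is connected) if all edges of some maximal acyclic subgraph of $G$ are revealed. A deterministic oblivious algorithm is a fixed sequence of queries $Q_1,Q_2,\dots$, determined in advance depending only on $n$, where each query is a set of station IDs and/or possible edges on $\{1,\dots,n\}$; at step $i$ exactly the stations whose ID or whose edge belongs to $Q_i$ broadcast their edges. Time is the number of steps needed until the edges of a spanning tree have been revealed. -}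

module Defs where

open import Data.Nat using (ℕ; _<_; _≤_; _*_)
open import Data.Fin using (Fin; toℕ)
open import Data.Bool using (Bool; _∨_; true; false)
open import Data.List using (List; []; _∷_; _++_; map; filter; length)
open import Data.List.Membership.Propositional using (_∈_; _∉_)
open import Data.List.Relation.Unary.All using (All)
open import Data.List.Relation.Unary.Unique.Propositional using (Unique)
open import Data.List.Relation.Unary.Linked using (Linked)
open import Data.Maybe using (Maybe; just; nothing)
open import Data.Product using (Σ; ∃; _×_; _,_; proj₁; proj₂)
open import Data.Sum using (_⊎_)
open import Relation.Nullary using (¬_)
open import Relation.Binary.PropositionalEquality using (_≡_)
open import Relation.Binary.Construct.Closure.ReflexiveTransitive using (Star)

-- Graphs on the vertex set Fin n (standing for {1,…,n}).
-- A possible edge is an ordered pair (u , v); an edge of a simple graph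
-- is stored in normal form with toℕ u < toℕ v.

Edge : ℕ → Set
Edge n = Fin n × Fin n

Adj : ∀ {n} → List (Edge n) → Fin n → Fin n → Set
Adj F u v = ((u , v) ∈ F) ⊎ ((v , u) ∈ F)

HasCycle : ∀ {n} → List (Edge n) → Set
HasCycle {n} F =
  Σ (Fin n) λ x → Σ (List (Fin n)) λ xs →
    (2 ≤ length xs) × Unique (x ∷ xs) × Linked (Adj F) (x ∷ xs ++ x ∷ [])

Acyclic : ∀ {n} → List (Edge n) → Set
Acyclic F = ¬ HasCycle F

MaximalAcyclicSub : ∀ {n} → List (Edge n) → List (Edge n) → Set
MaximalAcyclicSub E F =
  All (λ e → e ∈ E) F × Acyclic F ×
  (∀ e → e ∈ E → e ∉ F → HasCycle (e ∷ F))

Connected : ∀ {n} → List (Edge n) → Set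
Connected {n} E = (u v : Fin n) → Star (Adj E) u v

Station : ℕ → Set
Station n = ℕ × Edge n

-- an input: a simple graph on n vertices whose edges are held by stations,
-- one edge per station, distinct IDs, each edge held by exactly one station
Instance : ℕ → Set
Instance n = List (Station n)

edgesOf : ∀ {n} → Instance n → List (Edge n)
edgesOf = map proj₂

WellFormed : ∀ {n} → Instance n → Set
WellFormed I =
  Unique (map proj₁ I) × Unique (edgesOf I) ×
  All (λ s → toℕ (proj₁ (proj₂ s)) < toℕ (proj₂ (proj₂ s))) I

record Query (n : ℕ) : Set where
  field
    ids   : ℕ → Bool
    edges : Edge n → Bool
open Query public

broadcasts : ∀ {n} → Query n → Station n → Bool
broadcasts q (i , e) = ids q i ∨ edges q e

outcome : ∀ {n} → Query n → Instance n → Maybe (Edge n)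
outcome q I with filter (λ s → broadcasts q s Data.Bool.≟ true) I
... | s ∷ [] = just (proj₂ s)
... | _      = nothing

-- a deterministic oblivious algorithm: for each n a fixed sequence of
-- queries Q₀ , Q₁ , … (step t uses query A n t)
OblivAlg : Set
OblivAlg = (n : ℕ) → ℕ → Query n

RevealedBy : OblivAlg → ∀ n → Instance n → ℕ → Edge n → Set
RevealedBy A n I T e = ∃ λ t → (t < T) × (outcome (A n t) I ≡ just e)

FoundBy : OblivAlg → ∀ n → Instance n → ℕ → Set
FoundBy A n I T =
  Σ (List (Edge n)) λ F → MaximalAcyclicSub (edgesOf I) F ×
    All (RevealedBy A n I T) F

FindsSpanningForests : OblivAlg → Set
FindsSpanningForests A =
  ∀ n (I : Instance n) → WellFormed I → ∃ λ T → FoundBy A n I T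

-- The n vertices are split into two nearly equal sides, each carrying a
-- star; c = min(m , HK) crossing edges are the candidates, and only the
-- first T₀ = c / 3 queries of A are considered.  Station IDs are chosen so
-- that each early query selects all of them (a collision) or none
-- (homogeneous-ids); candidates are deleted, at most one per early query
-- selecting no star edge, until no such query selects exactly one kept
-- candidate (sparsify).  Then every edge revealed in the first T₀ steps is a
-- star edge (early-reveals-stars), while the stars plus any crossing edge
-- hang from a rooted forest (rooted⇒acyclic), so no maximal acyclic
-- subgraph is revealed within T₀ steps (found-late), although the instance
-- has Θ(c) = Θ(m) edges.
module Submission where

open import Defs
open import Data.Bool using (Bool; true; false; if_then_else_) renaming (_≟_ to _≟ᵇ_)
open import Data.Nat using (ℕ; zero; suc; _+_; _*_; _^_; _/_; _%_; _⊓_; _≤_; _<_; z≤n; s≤s; s≤s⁻¹; _≤?_; _<?_) renaming (_≟_ to _≟ℕ_)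
open import Data.Nat.Properties using (*-assoc; *-comm; *-distribˡ-+; *-identityʳ; *-monoʳ-≤; +-cancelʳ-≤; +-comm; +-identityʳ; +-mono-<; +-mono-≤; +-monoʳ-<; +-monoʳ-≤; +-suc; <-≤-trans; <⇒≱; m≤m+n; m≤n+m; m≤n⇒m≤1+n; m≤n⇒m⊓n≡m; m≥n⇒m⊓n≡n; m⊓n≤m; ⊓-glb; n≤1+n; suc-injective; ≤-refl; ≤-reflexive; ≤-trans; ≮⇒≥; ≰⇒>; ≰⇒≥; module ≤-Reasoning)
open import Data.Nat.DivMod using (m/n*n≤m; m≡m%n+[m/n]*n; m%n<n)
open import Data.Nat.Tactic.RingSolver using (solve-∀)
open import Data.Fin using (Fin; zero; suc; toℕ; _↑ˡ_; _↑ʳ_; splitAt; join)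
open import Data.Fin.Properties using (toℕ-↑ˡ; toℕ-↑ʳ; ↑ˡ-injective; ↑ʳ-injective; splitAt-↑ˡ; splitAt-↑ʳ; join-splitAt; toℕ<n; 0≢1+n) renaming (_≟_ to _≟ᶠ_; suc-injective to fsuc-injective)
open import Data.List using (List; []; _∷_; _++_; [_]; length; map; filter; take; upTo; zip; allFin; cartesianProductWith; initLast; _∷ʳ′_)
open import Data.List.Properties using (length-++; length-map; length-filter; length-take; length-upTo; length-tabulate; ++-assoc; filter-++; ∷-injectiveʳ)
open import Data.List.Extrema.Nat using (argmax; argmax-sel; f[⊥]≤f[argmax]; f[xs]≤f[argmax])
open import Data.List.Membership.Propositional using (_∈_; _∉_; find)
open import Data.List.Membership.Propositional.Properties using (∈-∃++; ∈-++⁻; ∈-++⁺ˡ; ∈-++⁺ʳ; ∈-map⁻; ∈-map⁺; ∈-filter⁻; ∈-filter⁺; ∈-upTo⁺; ∈-allFin; ∈-cartesianProductWith⁻)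
open import Data.List.Relation.Unary.Any using (here; there; any?)
open import Data.List.Relation.Unary.All as All using (All; []; _∷_)
import Data.List.Relation.Unary.All.Properties as AllP
open import Data.List.Relation.Unary.Unique.Propositional using (Unique; []; _∷_)
import Data.List.Relation.Unary.Unique.Propositional.Properties as Unique
open import Data.List.Relation.Unary.Linked as Linked using (Linked; [-]; _∷_)
open import Data.List.Relation.Binary.Sublist.Propositional using (_⊆_; []; _∷_; _∷ʳ_; ⊆-refl; ⊆-trans)
open import Data.List.Relation.Binary.Sublist.Propositional.Properties using (All-resp-⊆; Any-resp-⊆; filter-⊆; take-⊆; length-mono-≤)
open import Data.Maybe using (just)
open import Data.Product using (Σ; _×_; _,_; proj₁; proj₂)
open import Data.Sum using (_⊎_; inj₁; inj₂; [_,_]′)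
import Data.Sum as Sum
open import Data.Empty using (⊥; ⊥-elim)
open import Relation.Nullary using (¬_; Dec; does; yes; no)
open import Relation.Nullary.Decidable using (dec-true; dec-false)
open import Relation.Binary.PropositionalEquality using (_≡_; _≢_; refl; sym; trans; cong; cong₂; subst; subst₂; module ≡-Reasoning)
open import Relation.Binary.Construct.Closure.ReflexiveTransitive using (Star; ε; _◅_; _◅◅_)
import Relation.Binary.Construct.Closure.ReflexiveTransitive as Star

CycleAt : {A : Set} → (A → A → Set) → A → List A → Set
CycleAt R x xs = (2 ≤ length xs) × Unique (x ∷ xs) × Linked R (x ∷ xs ++ [ x ])

unique-rotate : {A : Set} (x : A) (zs : List A) → Unique (x ∷ zs) → Unique (zs ++ [ x ])
unique-rotate x []       _ = [] ∷ []
unique-rotate x (z ∷ zs) ((x≢z ∷ x∉zs) ∷ z∉zs ∷ u) =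
  AllP.++⁺ z∉zs ((λ z≡x → x≢z (sym z≡x)) ∷ []) ∷ unique-rotate x zs (x∉zs ∷ u)

linked-snoc : {A : Set} {R : A → A → Set} (w : A) (zs : List A) {x y : A} →
  Linked R (w ∷ zs ++ [ x ]) → R x y → Linked R (w ∷ (zs ++ [ x ]) ++ [ y ])
linked-snoc w []       (r ∷ [-]) rxy = r ∷ rxy ∷ [-]
linked-snoc w (z ∷ zs) (r ∷ l)   rxy = r ∷ linked-snoc z zs l rxy

linked-last : {A : Set} {R : A → A → Set} (ws : List A) {z v : A} →
  Linked R (ws ++ z ∷ v ∷ []) → R z v
linked-last []           (r ∷ _) = r
linked-last (_ ∷ [])     (_ ∷ l) = linked-last [] l
linked-last (_ ∷ w ∷ ws) (_ ∷ l) = linked-last (w ∷ ws) l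

cycle-rotate : {A : Set} {R : A → A → Set} (x y : A) (ys : List A) →
  CycleAt R x (y ∷ ys) → CycleAt R y (ys ++ [ x ])
cycle-rotate x y ys (long , distinct , (rxy ∷ walk)) =
  subst (2 ≤_) (sym (trans (length-++ ys) (+-comm (length ys) 1))) long ,
  unique-rotate x (y ∷ ys) distinct ,
  linked-snoc y ys walk rxy

cycle-from : {A : Set} {R : A → A → Set} {v : A} (P Q : List A) (x : A) (xs : List A) →
  x ∷ xs ≡ P ++ v ∷ Q → CycleAt R x xs →
  Σ (List A) λ ys → CycleAt R v ys × (∀ {u} → u ∈ v ∷ ys → u ∈ x ∷ xs)
cycle-from []      Q x xs       refl cyc = xs , cyc , λ u∈ → u∈
cycle-from (_ ∷ P) Q x []       _    (() , _)
cycle-from {v = v} (_ ∷ P) Q x (y ∷ ys) split cyc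
  with cycle-from P (Q ++ [ x ]) y (ys ++ [ x ]) split′ (cycle-rotate x y ys cyc)
  where
    split′ : y ∷ ys ++ [ x ] ≡ P ++ v ∷ Q ++ [ x ]
    split′ = trans (cong (_++ [ x ]) (∷-injectiveʳ split)) (++-assoc P (v ∷ Q) [ x ])
... | zs , cyc′ , same = zs , cyc′ , λ u∈ → back (same u∈)
  where
    back : ∀ {u} → u ∈ y ∷ ys ++ [ x ] → u ∈ x ∷ y ∷ ys
    back u∈ with ∈-++⁻ (y ∷ ys) u∈
    ... | inj₁ u∈ys       = there u∈ys
    ... | inj₂ (here u≡x) = here u≡x

cycle-neighbours : {A : Set} {R : A → A → Set} {v : A} {ys : List A} → CycleAt R v ys →
  Σ A λ y → Σ A λ z → y ≢ z × R v y × R z v × y ∈ ys × z ∈ ys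
cycle-neighbours {ys = ys} cyc with initLast ys
cycle-neighbours (() , _)     | []
cycle-neighbours (s≤s () , _) | [] ∷ʳ′ z
cycle-neighbours {R = R} {v} (_ , (_ ∷ y∉ ∷ _) , walk) | (y ∷ ws) ∷ʳ′ z =
  y , z , y≢z , Linked.head walk , linked-last (v ∷ y ∷ ws) walk′ , here refl , there z∈
  where
    walk′ : Linked R ((v ∷ y ∷ ws) ++ z ∷ v ∷ [])
    walk′ = subst (Linked R) (cong (λ t → v ∷ y ∷ t) (++-assoc ws [ z ] [ v ])) walk
    z∈ : z ∈ ws ++ [ z ]
    z∈ = ∈-++⁺ʳ ws (here refl)
    y≢z : y ≢ z
    y≢z y≡z = All.lookup y∉ z∈ y≡z

argmax∈ : {A : Set} (f : A → ℕ) (x : A) (xs : List A) → argmax f x xs ∈ x ∷ xs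
argmax∈ f x xs with argmax-sel f x xs
... | inj₁ ≡x  = here ≡x
... | inj₂ ∈xs = there ∈xs

argmax-maximal : {A : Set} (f : A → ℕ) (x : A) (xs : List A) → ∀ {u} → u ∈ x ∷ xs → f u ≤ f (argmax f x xs)
argmax-maximal f x xs (here refl) = f[⊥]≤f[argmax] {f = f} x xs
argmax-maximal f x xs (there u∈)  = All.lookup (f[xs]≤f[argmax] {f = f} x xs) u∈

Parent : ∀ {n} → (Fin n → ℕ) → (Fin n → Fin n) → Fin n → Fin n → Set
Parent dep par u v = (u ≡ par v) × (dep u < dep v)

Rooted : ∀ {n} → (Fin n → ℕ) → (Fin n → Fin n) → List (Edge n) → Set
Rooted dep par F = ∀ {u v} → (u , v) ∈ F → Parent dep par u v ⊎ Parent dep par v u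

adj-sym : ∀ {n} {F : List (Edge n)} {u v} → Adj F u v → Adj F v u
adj-sym (inj₁ uv∈) = inj₂ uv∈
adj-sym (inj₂ vu∈) = inj₁ vu∈

shallow-neighbour-is-parent : ∀ {n} {F : List (Edge n)} {dep par} → Rooted dep par F →
  ∀ {v w} → Adj F v w → dep w ≤ dep v → w ≡ par v
shallow-neighbour-is-parent rooted (inj₁ vw∈) w≤v with rooted vw∈
... | inj₁ (_ , v<w) = ⊥-elim (<⇒≱ v<w w≤v)
... | inj₂ (w≡ , _)  = w≡
shallow-neighbour-is-parent rooted (inj₂ wv∈) w≤v with rooted wv∈
... | inj₁ (w≡ , _)  = w≡
... | inj₂ (_ , v<w) = ⊥-elim (<⇒≱ v<w w≤v)

-- A rooted edge set is acyclic: started at its deepest vertex, a cycle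
-- would give that vertex two distinct neighbours that are both its parent.
rooted⇒acyclic : ∀ {n} {F : List (Edge n)} dep par → Rooted dep par F → Acyclic F
rooted⇒acyclic {F = F} dep par rooted (x , xs , cyc)
  with P , Q , split ← ∈-∃++ (argmax∈ dep x xs)
  with ys , cyc′ , same ← cycle-from P Q x xs split cyc
  with y , z , y≢z , vy , zv , y∈ , z∈ ← cycle-neighbours cyc′
  = y≢z (trans (parent-of vy (there y∈)) (sym (parent-of (adj-sym zv) (there z∈))))
  where
    deepest : Fin _
    deepest = argmax dep x xs
    parent-of : ∀ {u} → Adj F deepest u → u ∈ deepest ∷ ys → u ≡ par deepest
    parent-of adj u∈ = shallow-neighbour-is-parent rooted adj (argmax-maximal dep x xs (same u∈))

passing failing : {A : Set} → (A → Bool) → List A → List A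
passing p = filter (λ x → p x ≟ᵇ true)
failing p = filter (λ x → p x ≟ᵇ false)

count : {A : Set} → (A → Bool) → List A → ℕ
count p xs = length (passing p xs)

count-skip : {A : Set} (p : A → Bool) {x : A} (xs : List A) → p x ≡ false → count p (x ∷ xs) ≡ count p xs
count-skip p xs px rewrite px = refl

count+failing : {A : Set} (p : A → Bool) (xs : List A) → count p xs + length (failing p xs) ≡ length xs
count+failing p []       = refl
count+failing p (x ∷ xs) with p x
... | true  = cong suc (count+failing p xs)
... | false = trans (+-suc (count p xs) _) (cong suc (count+failing p xs))

count-mono : {A : Set} (p : A → Bool) {xs ys : List A} → xs ⊆ ys → count p xs ≤ count p ys
count-mono p []       = z≤n
count-mono p (y ∷ʳ τ) with p y
... | true  = m≤n⇒m≤1+n (count-mono p τ)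
... | false = count-mono p τ
count-mono p (_∷_ {x} refl τ) with p x
... | true  = s≤s (count-mono p τ)
... | false = count-mono p τ

unique-⊆ : {A : Set} {xs ys : List A} → xs ⊆ ys → Unique ys → Unique xs
unique-⊆ []         _        = []
unique-⊆ (_ ∷ʳ τ)   (_ ∷ u)  = unique-⊆ τ u
unique-⊆ (refl ∷ τ) (y∉ ∷ u) = All-resp-⊆ τ y∉ ∷ unique-⊆ τ u

drop-sole-hit : {A : Set} (p : A → Bool) (xs : List A) → count p xs ≡ 1 →
  Σ (List A) λ ys → ys ⊆ xs × length xs ≡ suc (length ys) × count p ys ≡ 0
drop-sole-hit p (x ∷ xs) one with p x in px
... | true  = xs , x ∷ʳ ⊆-refl , refl , suc-injective one
... | false with ys , ys⊆ , len , none ← drop-sole-hit p xs one =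
  x ∷ ys , refl ∷ ys⊆ , cong suc len , trans (count-skip p ys px) none

length-insert : {A : Set} (P : List A) (x : A) (Q : List A) → length (P ++ x ∷ Q) ≡ suc (length (P ++ Q))
length-insert []      x Q = refl
length-insert (_ ∷ P) x Q = cong suc (length-insert P x Q)

All-insert : {A : Set} {Pr : A → Set} (P : List A) {x : A} {Q : List A} →
  All Pr (P ++ Q) → Pr x → All Pr (P ++ x ∷ Q)
All-insert P all px with allP , allQ ← AllP.++⁻ P all = AllP.++⁺ allP (px ∷ allQ)

-- A test passed
-- by a single element is settled for good by deleting that element, since
-- counts only decrease along sublists; the fuel k bounds the number of
-- tests still unsettled.
sparsify-within : {A : Set} (k : ℕ) (tests : List (A → Bool)) (X : List A) → length tests ≤ k →
  Σ (List A) λ Y → Y ⊆ X × length X ≤ length Y + length tests × All (λ p → count p Y ≢ 1) tests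
sparsify-within k tests X bound with any? (λ p → count p X ≟ℕ 1) tests
... | no none = X , ⊆-refl , m≤m+n _ _ , AllP.¬Any⇒All¬ tests none
... | yes some with p , p∈ , one ← find some with ∈-∃++ p∈ | drop-sole-hit p X one
sparsify-within zero .(P ++ p ∷ Q) X bound | yes _ | P , Q , refl | _
  with () ← subst (_≤ 0) (length-insert P p Q) bound
sparsify-within (suc k) .(P ++ p ∷ Q) X bound | yes _ | P , Q , refl | X′ , X′⊆X , lenX , none
  with Y , Y⊆X′ , lenX′ , settled ← sparsify-within k (P ++ Q) X′ (s≤s⁻¹ (subst (_≤ suc k) (length-insert P p Q) bound))
  = Y , ⊆-trans Y⊆X′ X′⊆X , shorter , All-insert P settled p-settled
  where
    shorter : length X ≤ length Y + length (P ++ p ∷ Q)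
    shorter rewrite lenX | length-insert P p Q | +-suc (length Y) (length (P ++ Q)) = s≤s lenX′
    p-settled : count p Y ≢ 1
    p-settled one′ with () ← subst₂ _≤_ one′ none (count-mono p Y⊆X′)

sparsify : {A : Set} (tests : List (A → Bool)) (X : List A) →
  Σ (List A) λ Y → Y ⊆ X × length X ≤ length Y + length tests × All (λ p → count p Y ≢ 1) tests
sparsify tests X = sparsify-within (length tests) tests X ≤-refl

++-singleton : {A : Set} (as bs : List A) {f : A} → as ++ bs ≡ f ∷ [] →
  (as ≡ [] × bs ≡ f ∷ []) ⊎ (as ≡ f ∷ [] × bs ≡ [])
++-singleton []          bs      eq = inj₁ (refl , eq)
++-singleton (a ∷ [])    []      eq = inj₂ (eq , refl)
++-singleton (a ∷ [])    (_ ∷ _) ()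
++-singleton (a ∷ _ ∷ _) _       ()

sole-hit-left : {A : Set} (p : A → Bool) (xs ys : List A) {f : A} →
  passing p (xs ++ ys) ≡ f ∷ [] → (count p xs ≡ 0 → count p ys ≢ 1) → f ∈ xs
sole-hit-left p xs ys sole not-sole
  with ++-singleton (passing p xs) (passing p ys) (trans (sym (filter-++ _ xs ys)) sole)
... | inj₁ (none , one) = ⊥-elim (not-sole (cong length none) (cong length one))
... | inj₂ (one , _)    = proj₁ (∈-filter⁻ (λ x → p x ≟ᵇ true) (subst (_ ∈_) (sym one) (here refl)))

nonempty-element : {A : Set} {xs : List A} → 1 ≤ length xs → Σ A (_∈ xs)
nonempty-element {xs = x ∷ _} _ = x , here refl

Constant : {A : Set} → (A → Bool) → List A → Set
Constant f L = All (λ i → f i ≡ true) L ⊎ All (λ i → f i ≡ false) L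

half-of-sum : ∀ {a b c} → c + c ≤ a + b → c ≤ a ⊎ c ≤ b
half-of-sum {a} {b} {c} le with c ≤? a | c ≤? b
... | yes c≤a | _       = inj₁ c≤a
... | no _    | yes c≤b = inj₂ c≤b
... | no c≰a  | no c≰b  = ⊥-elim (<⇒≱ (+-mono-< (≰⇒> c≰a) (≰⇒> c≰b)) le)

double : ∀ k t → k * 2 ^ suc t ≡ k * 2 ^ t + k * 2 ^ t
double k t = trans (cong (λ x → k * (2 ^ t + x)) (+-identityʳ (2 ^ t))) (*-distribˡ-+ k (2 ^ t) (2 ^ t))

-- Pigeonhole: splitting by one test after another, among k · 2^|fs|
-- candidates there is a sublist of k elements on which every test is constant.
homogeneous-sublist : {A : Set} (fs : List (A → Bool)) (k : ℕ) (L₀ : List A) →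
  k * 2 ^ length fs ≤ length L₀ →
  Σ (List A) λ L → L ⊆ L₀ × k ≤ length L × All (λ f → Constant f L) fs
homogeneous-sublist [] k L₀ big = L₀ , ⊆-refl , subst (_≤ length L₀) (*-identityʳ k) big , []
homogeneous-sublist (f ∷ fs) k L₀ big
  with half-of-sum (subst₂ _≤_ (double k (length fs)) (sym (count+failing f L₀)) big)
... | inj₁ many-pass with L , L⊆ , long , constant ← homogeneous-sublist fs k (passing f L₀) many-pass =
  L , ⊆-trans L⊆ (filter-⊆ _ L₀) , long , inj₁ (All-resp-⊆ L⊆ (AllP.all-filter _ L₀)) ∷ constant
... | inj₂ many-fail with L , L⊆ , long , constant ← homogeneous-sublist fs k (failing f L₀) many-fail =
  L , ⊆-trans L⊆ (filter-⊆ _ L₀) , long , inj₂ (All-resp-⊆ L⊆ (AllP.all-filter _ L₀)) ∷ constant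

homogeneous-ids : (fs : List (ℕ → Bool)) (k : ℕ) →
  Σ (List ℕ) λ L → length L ≡ k × Unique L × All (λ f → Constant f L) fs
homogeneous-ids fs k
  with L , L⊆ , long , constant ← homogeneous-sublist fs k (upTo (k * 2 ^ length fs)) (≤-reflexive (sym (length-upTo _)))
  = take k L ,
    trans (length-take k L) (m≤n⇒m⊓n≡m long) ,
    unique-⊆ (⊆-trans (take-⊆ k L) L⊆) (Unique.upTo⁺ _) ,
    All.map (Sum.map (All-resp-⊆ (take-⊆ k L)) (All-resp-⊆ (take-⊆ k L))) constant

broadcasters : ∀ {n} → Query n → Instance n → Instance n
broadcasters q = filter (λ s → broadcasts q s ≟ᵇ true)

revealed-sole : ∀ {n} (q : Query n) (I : Instance n) {f : Edge n} → outcome q I ≡ just f →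
  Σ (Station n) λ s → broadcasters q I ≡ s ∷ [] × proj₂ s ≡ f
revealed-sole q I eq with broadcasters q I
revealed-sole q I refl | s ∷ [] = s , refl , refl
revealed-sole q I ()   | []
revealed-sole q I ()   | _ ∷ _ ∷ _

module _ {n : ℕ} where

  zip-ids : (L : List ℕ) (es : List (Edge n)) → length L ≡ length es → map proj₁ (zip L es) ≡ L
  zip-ids []      []       _   = refl
  zip-ids (i ∷ L) (e ∷ es) len = cong (i ∷_) (zip-ids L es (suc-injective len))

  zip-edges : (L : List ℕ) (es : List (Edge n)) → length L ≡ length es → edgesOf (zip L es) ≡ es
  zip-edges []      []       _   = refl
  zip-edges (i ∷ L) (e ∷ es) len = cong (e ∷_) (zip-edges L es (suc-injective len))

  all-broadcast : (q : Query n) (L : List ℕ) (es : List (Edge n)) →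
    All (λ i → ids q i ≡ true) L → broadcasters q (zip L es) ≡ zip L es
  all-broadcast q []      _        _            = refl
  all-broadcast q (i ∷ L) []       _            = refl
  all-broadcast q (i ∷ L) (e ∷ es) (sel ∷ sels) rewrite sel = cong ((i , e) ∷_) (all-broadcast q L es sels)

  edge-broadcast : (q : Query n) (L : List ℕ) (es : List (Edge n)) →
    All (λ i → ids q i ≡ false) L → length L ≡ length es →
    edgesOf (broadcasters q (zip L es)) ≡ passing (edges q) es
  edge-broadcast q []      []       _                _   = refl
  edge-broadcast q (i ∷ L) (e ∷ es) (unsel ∷ unsels) len rewrite unsel with edges q e
  ... | true  = cong (e ∷_) (edge-broadcast q L es unsels (suc-injective len))
  ... | false = edge-broadcast q L es unsels (suc-injective len)

  collision : (q : Query n) (L : List ℕ) (es : List (Edge n)) {f : Edge n} →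
    All (λ i → ids q i ≡ true) L → 2 ≤ length L → length L ≡ length es →
    outcome q (zip L es) ≡ just f → ⊥
  collision q (_ ∷ [])     _              _    (s≤s ()) _  _
  collision q (_ ∷ _ ∷ _)  (_ ∷ [])       _    _        () _
  collision q L@(_ ∷ _ ∷ _) es@(_ ∷ _ ∷ _) sels _        _  revealed
    with _ , single , _ ← revealed-sole q _ revealed
    with () ← ∷-injectiveʳ (trans (sym (all-broadcast q L es sels)) single)

  revealed-by-edges : (q : Query n) (L : List ℕ) (es : List (Edge n)) {f : Edge n} →
    All (λ i → ids q i ≡ false) L → length L ≡ length es →
    outcome q (zip L es) ≡ just f → passing (edges q) es ≡ f ∷ []
  revealed-by-edges q L es unsels len revealed with _ , single , holds-f ← revealed-sole q (zip L es) revealed =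
    trans (sym (edge-broadcast q L es unsels len)) (trans (cong edgesOf single) (cong (_∷ []) holds-f))

length-allFin : ∀ m → length (allFin m) ≡ m
length-allFin m = length-tabulate {n = m} (λ x → x)

length-cartesianProductWith : {A B C : Set} (f : A → B → C) (xs : List A) (ys : List B) →
  length (cartesianProductWith f xs ys) ≡ length xs * length ys
length-cartesianProductWith f []       ys = refl
length-cartesianProductWith f (x ∷ xs) ys =
  trans (length-++ (map (f x) ys)) (cong₂ _+_ (length-map (f x) ys) (length-cartesianProductWith f xs ys))

spoke : ∀ {m} → Fin (suc m) → ℕ
spoke zero    = 0
spoke (suc _) = 1

spoke≤1 : ∀ {m} (a : Fin (suc m)) → spoke a ≤ 1
spoke≤1 zero    = z≤n
spoke≤1 (suc _) = ≤-refl

-- The vertex set Fin (H + K) consists of a left side Fin H and a right side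
-- Fin K; each side carries a star centred at zero, and the crossing edges
-- join the two sides.
module TwoStars (h k : ℕ) where

  H K N : ℕ
  H = suc h
  K = suc k
  N = H + K

  left : Fin H → Fin N
  left a = a ↑ˡ K

  right : Fin K → Fin N
  right b = H ↑ʳ b

  left≢right : ∀ a b → left a ≢ right b
  left≢right a b eq with () ← trans (sym (splitAt-↑ˡ H a K)) (trans (cong (splitAt H) eq) (splitAt-↑ʳ H K b))

  side : ∀ v → (Σ (Fin H) λ a → v ≡ left a) ⊎ (Σ (Fin K) λ b → v ≡ right b)
  side v with splitAt H v in eq
  ... | inj₁ a = inj₁ (a , trans (sym (join-splitAt H K v)) (cong (join H K) eq))
  ... | inj₂ b = inj₂ (b , trans (sym (join-splitAt H K v)) (cong (join H K) eq))

  leftStar rightStar stars crossing : List (Edge N)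
  leftStar  = map (λ a → left zero , left (suc a)) (allFin h)
  rightStar = map (λ b → right zero , right (suc b)) (allFin k)
  stars     = leftStar ++ rightStar
  crossing  = cartesianProductWith (λ a b → left a , right b) (allFin H) (allFin K)

  data StarEdge : Edge N → Set where
    left-spoke  : ∀ a → StarEdge (left zero , left (suc a))
    right-spoke : ∀ b → StarEdge (right zero , right (suc b))

  star-edge : ∀ {e} → e ∈ stars → StarEdge e
  star-edge e∈ with ∈-++⁻ leftStar e∈
  ... | inj₁ e∈l with a , _ , refl ← ∈-map⁻ _ e∈l = left-spoke a
  ... | inj₂ e∈r with b , _ , refl ← ∈-map⁻ _ e∈r = right-spoke b

  crossing-edge : ∀ {e} → e ∈ crossing → Σ (Fin H) λ a → Σ (Fin K) λ b → e ≡ (left a , right b)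
  crossing-edge e∈ with a , b , _ , _ , eq ← ∈-cartesianProductWith⁻ _ (allFin H) (allFin K) e∈ = a , b , eq

  stars∌crossing : ∀ {e} → e ∈ stars → e ∉ crossing
  stars∌crossing e∈s e∈c with a , b , e≡ ← crossing-edge e∈c = not-crossing (star-edge e∈s) e≡
    where
      not-crossing : ∀ {e} → StarEdge e → e ≢ (left a , right b)
      not-crossing (left-spoke _)  eq = left≢right _ b (cong proj₂ eq)
      not-crossing (right-spoke _) eq = left≢right a _ (sym (cong proj₁ eq))

  length-stars : length stars ≡ h + k
  length-stars = trans (length-++ leftStar)
    (cong₂ _+_ (trans (length-map _ (allFin h)) (length-allFin h)) (trans (length-map _ (allFin k)) (length-allFin k)))

  length-crossing : length crossing ≡ H * K
  length-crossing = trans (length-cartesianProductWith _ (allFin H) (allFin K)) (cong₂ _*_ (length-allFin H) (length-allFin K))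

  unique-stars : Unique stars
  unique-stars = Unique.++⁺ (Unique.map⁺ left-injective (Unique.allFin⁺ h))
                            (Unique.map⁺ right-injective (Unique.allFin⁺ k)) sides-apart
    where
      left-injective : ∀ {a a′} → (left zero , left (suc a)) ≡ (left zero , left (suc a′)) → a ≡ a′
      left-injective eq = fsuc-injective (↑ˡ-injective K _ _ (cong proj₂ eq))
      right-injective : ∀ {b b′} → (right zero , right (suc b)) ≡ (right zero , right (suc b′)) → b ≡ b′
      right-injective eq = fsuc-injective (↑ʳ-injective H _ _ (cong proj₂ eq))
      sides-apart : ∀ {e} → ¬ (e ∈ leftStar × e ∈ rightStar)
      sides-apart (e∈l , e∈r) with _ , _ , refl ← ∈-map⁻ _ e∈l | _ , _ , eq ← ∈-map⁻ _ e∈r =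
        left≢right zero zero (cong proj₁ eq)

  unique-crossing : Unique crossing
  unique-crossing = Unique.cartesianProductWith⁺ _ pair-injective (Unique.allFin⁺ H) (Unique.allFin⁺ K)
    where
      pair-injective : ∀ {a a′ b b′} → (left a , right b) ≡ (left a′ , right b′) → a ≡ a′ × b ≡ b′
      pair-injective eq = ↑ˡ-injective K _ _ (cong proj₁ eq) , ↑ʳ-injective H _ _ (cong proj₂ eq)

  Ordered : Edge N → Set
  Ordered e = toℕ (proj₁ e) < toℕ (proj₂ e)

  stars-ordered : ∀ {e} → e ∈ stars → Ordered e
  stars-ordered e∈ with star-edge e∈
  ... | left-spoke a  = s≤s z≤n
  ... | right-spoke b rewrite toℕ-↑ʳ H (zero {k}) | toℕ-↑ʳ H (suc b) = +-monoʳ-< H (s≤s z≤n)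

  crossing-ordered : ∀ {e} → e ∈ crossing → Ordered e
  crossing-ordered e∈ with a , b , refl ← crossing-edge e∈
    rewrite toℕ-↑ˡ a K | toℕ-↑ʳ H b = ≤-trans (toℕ<n a) (m≤m+n H (toℕ b))

  -- The stars together with any one crossing edge connect all vertices:
  -- every vertex reaches the left centre.
  connected : (E : List (Edge N)) {i : Fin H} {j : Fin K} →
    (∀ {e} → e ∈ stars → e ∈ E) → (left i , right j) ∈ E → Connected E
  connected E {i} {j} stars⊆E ij∈E u v = to-hub u ◅◅ Star.reverse adj-sym (to-hub v)
    where
      hub : Fin N
      hub = left zero
      left-to-hub : ∀ a → Star (Adj E) (left a) hub
      left-to-hub zero    = ε
      left-to-hub (suc a) = inj₂ (stars⊆E (∈-++⁺ˡ (∈-map⁺ _ (∈-allFin a)))) ◅ ε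
      right-to-centre : ∀ b → Star (Adj E) (right b) (right zero)
      right-to-centre zero    = ε
      right-to-centre (suc b) = inj₂ (stars⊆E (∈-++⁺ʳ leftStar (∈-map⁺ _ (∈-allFin b)))) ◅ ε
      to-hub : ∀ w → Star (Adj E) w hub
      to-hub w with side w
      ... | inj₁ (a , refl) = left-to-hub a
      ... | inj₂ (b , refl) =
        right-to-centre b ◅◅ Star.reverse adj-sym (right-to-centre j) ◅◅ inj₂ ij∈E ◅ left-to-hub i

  -- The stars plus one crossing edge (left i , right j) hang from the left
  -- centre: the left spokes below it, right j below left i, and the rest of
  -- the right star below right j through the right centre (or directly,
  -- when j is the right centre).
  module CrossTree (i : Fin H) (j : Fin K) where

    -- Depths: left centre 0, left spokes 1, right j 2, right centre 3
    -- (unless it is j), the other right vertices 4.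
    depthR : Fin K → ℕ
    depthR b = if does (b ≟ᶠ j) then 2 else 3 + spoke b

    parentR : Fin K → Fin N
    parentR zero    = if does (zero ≟ᶠ j) then left i else right j
    parentR (suc b) = if does (suc b ≟ᶠ j) then left i else right zero

    depth : Fin N → ℕ
    depth v = [ spoke , depthR ]′ (splitAt H v)

    parent : Fin N → Fin N
    parent v = [ (λ _ → left zero) , parentR ]′ (splitAt H v)

    depth-left : ∀ a → depth (left a) ≡ spoke a
    depth-left a = cong [ spoke , depthR ]′ (splitAt-↑ˡ H a K)

    depth-right : ∀ b → depth (right b) ≡ depthR b
    depth-right b = cong [ spoke , depthR ]′ (splitAt-↑ʳ H K b)

    parent-left : ∀ a → parent (left a) ≡ left zero
    parent-left a = cong [ (λ _ → left zero) , parentR ]′ (splitAt-↑ˡ H a K)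

    parent-right : ∀ b → parent (right b) ≡ parentR b
    parent-right b = cong [ (λ _ → left zero) , parentR ]′ (splitAt-↑ʳ H K b)

    parentR-j : ∀ b → b ≡ j → parentR b ≡ left i
    parentR-j zero    b≡j rewrite dec-true (zero ≟ᶠ j) b≡j = refl
    parentR-j (suc b) b≡j rewrite dec-true (suc b ≟ᶠ j) b≡j = refl

    depthR-centre≤3 : depthR zero ≤ 3
    depthR-centre≤3 with does (zero ≟ᶠ j)
    ... | true  = s≤s (s≤s z≤n)
    ... | false = ≤-refl

    rooted : Rooted depth parent ((left i , right j) ∷ stars)
    rooted (here refl) rewrite parent-right j | depth-left i | depth-right j | dec-true (j ≟ᶠ j) refl =
      inj₁ (sym (parentR-j j refl) , s≤s (spoke≤1 i))
    rooted (there e∈) with star-edge e∈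
    ... | left-spoke a rewrite parent-left (suc a) | depth-left zero | depth-left (suc a) =
      inj₁ (refl , s≤s z≤n)
    ... | right-spoke b rewrite parent-right zero | parent-right (suc b) | depth-right zero | depth-right (suc b)
      with suc b ≟ᶠ j
    ...   | yes sb≡j rewrite dec-false (zero ≟ᶠ j) (λ 0≡j → 0≢1+n (trans 0≡j (sym sb≡j))) =
      inj₂ (cong right sb≡j , s≤s (s≤s (s≤s z≤n)))
    ...   | no  _ = inj₁ (refl , s≤s depthR-centre≤3)

thrice : ∀ t → t + t + t ≡ 3 * t
thrice = solve-∀

thrice-suc : ∀ t → 3 * t + 3 ≡ 3 * suc t
thrice-suc = solve-∀

Third : ℕ → ℕ → Set
Third c T = 3 * T ≤ c × c ≤ 3 * T + 2

third : ∀ c → Third c (c / 3)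
third c = subst (_≤ c) (*-comm (c / 3) 3) (m/n*n≤m c 3) , upper
  where
    open ≤-Reasoning
    upper : c ≤ 3 * (c / 3) + 2
    upper = begin
      c                   ≡⟨ m≡m%n+[m/n]*n c 3 ⟩
      c % 3 + c / 3 * 3   ≡⟨ +-comm (c % 3) _ ⟩
      c / 3 * 3 + c % 3   ≤⟨ +-mono-≤ (≤-reflexive (*-comm (c / 3) 3)) (s≤s⁻¹ (m%n<n c 3)) ⟩
      3 * (c / 3) + 2     ∎

module _ {c T y : ℕ} (isThird : Third c T) (c≤y+T : c ≤ y + T) where
  open ≤-Reasoning

  two-thirds≤ : T + T ≤ y
  two-thirds≤ = +-cancelʳ-≤ T (T + T) y (begin
    T + T + T   ≡⟨ thrice T ⟩
    3 * T       ≤⟨ proj₁ isThird ⟩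
    c           ≤⟨ c≤y+T ⟩
    y + T       ∎)

  c≤2y : c ≤ 2 * y
  c≤2y = begin
    c           ≤⟨ c≤y+T ⟩
    y + T       ≤⟨ +-monoʳ-≤ y (≤-trans (m≤m+n T T) two-thirds≤) ⟩
    y + y       ≡⟨ cong (y +_) (+-identityʳ y) ⟨
    2 * y       ∎

  at-least-two : 1 ≤ T → 2 ≤ y
  at-least-two 1≤T = ≤-trans (+-mono-≤ 1≤T 1≤T) two-thirds≤

third-exceeded : ∀ {c T t} → Third c T → T < t → c ≤ 3 * t
third-exceeded {c} {T} {t} isThird T<t = begin
  c              ≤⟨ proj₂ isThird ⟩
  3 * T + 2      ≤⟨ +-monoʳ-≤ (3 * T) (n≤1+n 2) ⟩
  3 * T + 3      ≡⟨ thrice-suc T ⟩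
  3 * suc T      ≤⟨ *-monoʳ-≤ 3 T<t ⟩
  3 * t          ∎
  where open ≤-Reasoning

positive-half : ∀ y → 1 ≤ 2 * y → 1 ≤ y
positive-half (suc _) _ = s≤s z≤n

module HardInstance (A : OblivAlg) (h k m : ℕ) (m-positive : 1 ≤ m) where
  open TwoStars h k

  X : List (Edge N)
  X = take m crossing

  c T₀ : ℕ
  c  = length X
  T₀ = c / 3

  c≡ : c ≡ m ⊓ (H * K)
  c≡ = trans (length-take m crossing) (cong (m ⊓_) length-crossing)

  early : List (Query N)
  early = map (A N) (upTo T₀)

  early-query : ∀ {t} → t < T₀ → A N t ∈ early
  early-query t<T₀ = ∈-map⁺ (A N) (∈-upTo⁺ t<T₀)

  quiet? : (q : Query N) → Dec (count (edges q) stars ≡ 0)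
  quiet? q = count (edges q) stars ≟ℕ 0

  quietTests : List (Edge N → Bool)
  quietTests = map edges (filter quiet? early)

  few-tests : length quietTests ≤ T₀
  few-tests = begin
    length quietTests            ≡⟨ length-map edges (filter quiet? early) ⟩
    length (filter quiet? early) ≤⟨ length-filter quiet? early ⟩
    length early                 ≡⟨ length-map (A N) (upTo T₀) ⟩
    length (upTo T₀)             ≡⟨ length-upTo T₀ ⟩
    T₀                           ∎
    where open ≤-Reasoning

  -- The kept candidates Y: no quiet test selects exactly one of them.  Only
  -- the stated properties of this choice (and of the IDs below) are used, so
  -- both choices are opaque.
  opaque
    sparse : Σ (List (Edge N)) λ Y → Y ⊆ X × length X ≤ length Y + length quietTests ×
               All (λ p → count p Y ≢ 1) quietTests
    sparse = sparsify quietTests X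

  Y : List (Edge N)
  Y = proj₁ sparse

  Y⊆X : Y ⊆ X
  Y⊆X = proj₁ (proj₂ sparse)

  settled : All (λ p → count p Y ≢ 1) quietTests
  settled = proj₂ (proj₂ (proj₂ sparse))

  c≤Y+T₀ : c ≤ length Y + T₀
  c≤Y+T₀ = ≤-trans (proj₁ (proj₂ (proj₂ sparse))) (+-monoʳ-≤ (length Y) few-tests)

  Y⊆crossing : Y ⊆ crossing
  Y⊆crossing = ⊆-trans Y⊆X (take-⊆ m crossing)

  stars∌Y : ∀ {e} → e ∈ stars → e ∉ Y
  stars∌Y e∈s e∈Y = stars∌crossing e∈s (Any-resp-⊆ Y⊆crossing e∈Y)

  c≤2Y : c ≤ 2 * length Y
  c≤2Y = c≤2y {y = length Y} (third c) c≤Y+T₀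

  c-positive : 1 ≤ c
  c-positive = subst (1 ≤_) (sym c≡) (⊓-glb m-positive (s≤s z≤n))

  kept : Σ (Fin H) λ i → Σ (Fin K) λ j → (left i , right j) ∈ Y
  kept with _ , e∈Y ← nonempty-element (positive-half (length Y) (≤-trans c-positive c≤2Y))
    with i , j , refl ← crossing-edge (Any-resp-⊆ Y⊆crossing e∈Y) = i , j , e∈Y

  i₀ : Fin H
  i₀ = proj₁ kept

  j₀ : Fin K
  j₀ = proj₁ (proj₂ kept)

  kept∈Y : (left i₀ , right j₀) ∈ Y
  kept∈Y = proj₂ (proj₂ kept)

  E : List (Edge N)
  E = stars ++ Y

  opaque
    ids-choice : Σ (List ℕ) λ L → length L ≡ length E × Unique L × All (λ f → Constant f L) (map ids early)
    ids-choice = homogeneous-ids (map ids early) (length E)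

  L : List ℕ
  L = proj₁ ids-choice

  length-L : length L ≡ length E
  length-L = proj₁ (proj₂ ids-choice)

  I : Instance N
  I = zip L E

  edges-I : edgesOf I ≡ E
  edges-I = zip-edges L E length-L

  wellFormed : WellFormed I
  wellFormed =
    subst Unique (sym (zip-ids L E length-L)) (proj₁ (proj₂ (proj₂ ids-choice))) ,
    subst Unique (sym edges-I) (Unique.++⁺ unique-stars (unique-⊆ Y⊆crossing unique-crossing) (λ (s , y) → stars∌Y s y)) ,
    AllP.map⁻ (subst (All Ordered) (sym edges-I)
      (AllP.++⁺ (All.tabulate stars-ordered) (All.tabulate (λ e∈Y → crossing-ordered (Any-resp-⊆ Y⊆crossing e∈Y)))))

  connected-I : Connected (edgesOf I)
  connected-I = subst Connected (sym edges-I) (connected E ∈-++⁺ˡ (∈-++⁺ʳ stars kept∈Y))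

  -- Within the first T₀ steps only star edges are revealed: if the query
  -- selects all IDs, the ≥ 2 stations collide; if it selects none, the
  -- revealed edge is the only edge it selects, and a quiet query does not
  -- select exactly one kept candidate.
  early-reveals-stars : ∀ {t f} → t < T₀ → outcome (A N t) I ≡ just f → f ∈ stars
  early-reveals-stars {t} t<T₀ revealed
    with All.lookup (proj₂ (proj₂ (proj₂ ids-choice))) (∈-map⁺ ids (early-query t<T₀))
  ... | inj₁ all-selected = ⊥-elim (collision (A N t) L E all-selected two-stations length-L revealed)
    where
      two-stations : 2 ≤ length L
      two-stations = begin
        2                          ≤⟨ at-least-two {y = length Y} (third c) c≤Y+T₀ (≤-trans (s≤s z≤n) t<T₀) ⟩
        length Y                   ≤⟨ m≤n+m (length Y) (length stars) ⟩
        length stars + length Y    ≡⟨ length-++ stars ⟨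
        length E                   ≡⟨ length-L ⟨
        length L                   ∎
        where open ≤-Reasoning
  ... | inj₂ none-selected =
    sole-hit-left (edges (A N t)) stars Y (revealed-by-edges (A N t) L E none-selected length-L revealed)
      (λ quiet → All.lookup settled (∈-map⁺ edges (∈-filter⁺ quiet? (early-query t<T₀) quiet)))

  -- Hence no spanning forest is found within T₀ steps: its edges would all
  -- be star edges, so adding the kept candidate could not close a cycle.
  found-late : ∀ T → FoundBy A N I T → T₀ < T
  found-late T (F , (_ , _ , maximal) , revealed) with T₀ <? T
  ... | yes T₀<T = T₀<T
  ... | no  T₀≮T = ⊥-elim (rooted⇒acyclic depth parent rooted-F (maximal (left i₀ , right j₀) kept∈I kept∉F))
    where
      open CrossTree i₀ j₀
      F⊆stars : All (_∈ stars) F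
      F⊆stars = All.map (λ (t , t<T , eq) → early-reveals-stars (<-≤-trans t<T (≮⇒≥ T₀≮T)) eq) revealed
      kept∈I : (left i₀ , right j₀) ∈ edgesOf I
      kept∈I = subst ((left i₀ , right j₀) ∈_) (sym edges-I) (∈-++⁺ʳ stars kept∈Y)
      kept∉F : (left i₀ , right j₀) ∉ F
      kept∉F kept∈F = stars∌Y (All.lookup F⊆stars kept∈F) kept∈Y
      rooted-F : Rooted depth parent ((left i₀ , right j₀) ∷ F)
      rooted-F (here refl) = rooted (here refl)
      rooted-F (there e∈F) = rooted (there (All.lookup F⊆stars e∈F))

  length-I : length I ≡ (h + k) + length Y
  length-I = begin
    length I                  ≡⟨ length-map proj₂ I ⟨
    length (edgesOf I)        ≡⟨ cong length edges-I ⟩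
    length E                  ≡⟨ length-++ stars ⟩
    length stars + length Y   ≡⟨ cong (_+ length Y) length-stars ⟩
    (h + k) + length Y        ∎
    where open ≡-Reasoning

  hard-instance : Σ (Instance N) λ I → WellFormed I × Connected (edgesOf I) ×
    (c ≤ 2 * length I) × (length I ≤ (h + k) + c) × ((T : ℕ) → FoundBy A N I T → c ≤ 3 * T)
  hard-instance =
    I , wellFormed , connected-I ,
    ≤-trans c≤2Y (*-monoʳ-≤ 2 (subst (length Y ≤_) (sym length-I) (m≤n+m (length Y) (h + k)))) ,
    subst (_≤ (h + k) + c) (sym length-I) (+-monoʳ-≤ (h + k) (length-mono-≤ Y⊆X)) ,
    λ T found → third-exceeded (third c) (found-late T found)

halves : ∀ n → 2 ≤ n → Σ ℕ λ h → Σ ℕ λ k → (n ≡ suc h + suc k) × (k ≡ h ⊎ k ≡ suc h)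
halves (suc zero)          (s≤s ())
halves (suc (suc zero))    _ = 0 , 0 , refl , inj₁ refl
halves (suc (suc (suc n))) _ with halves (suc (suc n)) (s≤s (s≤s z≤n))
... | h , .h       , eq , inj₁ refl = h , suc h , trans (cong suc eq) (sym (+-suc (suc h) (suc h))) , inj₂ refl
... | h , .(suc h) , eq , inj₂ refl = suc h , suc h , cong suc eq , inj₁ refl

balanced : ∀ h k → (k ≡ h ⊎ k ≡ suc h) → (suc h + suc k) * (suc h + suc k) ≤ 8 * (suc h * suc k)
balanced h .h       (inj₁ refl) = ≤-trans (m≤m+n _ _) (≤-reflexive (equal-parts (suc h)))
  where
    equal-parts : ∀ x → (x + x) * (x + x) + 4 * (x * x) ≡ 8 * (x * x)
    equal-parts = solve-∀
balanced h .(suc h) (inj₂ refl) = ≤-trans (m≤m+n _ _) (≤-reflexive (adjacent-parts h))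
  where
    adjacent-parts : ∀ x → (suc x + suc (suc x)) * (suc x + suc (suc x)) + (4 * (x * x) + 12 * x + 7)
                           ≡ 8 * (suc x * suc (suc x))
    adjacent-parts = solve-∀

≤-scaled-min : ∀ m p r → m ≤ r * p → m ≤ suc r * (m ⊓ p)
≤-scaled-min m p r m≤rp with m ≤? p
... | yes m≤p rewrite m≤n⇒m⊓n≡m m≤p = m≤m+n m (r * m)
... | no  m≰p rewrite m≥n⇒m⊓n≡n (≰⇒≥ m≰p) = ≤-trans m≤rp (m≤n+m (r * p) p)

≤-scale : ∀ {m} r {c} j x → m ≤ r * c → c ≤ j * x → m ≤ (r * j) * x
≤-scale r j x m≤rc c≤jx = ≤-trans m≤rc (≤-trans (*-monoʳ-≤ r c≤jx) (≤-reflexive (sym (*-assoc r j x))))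

enough-candidates : ∀ C h k m → (k ≡ h ⊎ k ≡ suc h) → m ≤ C * ((suc h + suc k) * (suc h + suc k)) →
  m ≤ suc (8 * C) * (m ⊓ (suc h * suc k))
enough-candidates C h k m nearly-equal m≤Cn² = ≤-scaled-min m (suc h * suc k) (8 * C) (begin
  m                                        ≤⟨ m≤Cn² ⟩
  C * ((suc h + suc k) * (suc h + suc k))  ≤⟨ *-monoʳ-≤ C (balanced h k nearly-equal) ⟩
  C * (8 * (suc h * suc k))                ≡⟨ reorder C (suc h * suc k) ⟩
  (8 * C) * (suc h * suc k)                ∎)
  where
    open ≤-Reasoning
    reorder : ∀ x y → x * (8 * y) ≡ (8 * x) * y
    reorder = solve-∀

-- The theorem for a given n: split n into nearly equal sides and take the
-- hard instance with m candidates; its bounds in terms of c = min(m , HK)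
-- become bounds in terms of m since m ≤ (1 + 8C) c ≤ 2m.
lower-bound : (C : ℕ) (A : OblivAlg) (n m : ℕ) → 2 ≤ n → n ≤ m → m ≤ C * (n * n) →
  Σ (Instance n) λ I → WellFormed I × Connected (edgesOf I) ×
    (m ≤ suc (8 * C) * 2 * length I) × (length I ≤ 2 * m) ×
    ((T : ℕ) → FoundBy A n I T → m ≤ suc (8 * C) * 3 * T)
lower-bound C A n m 2≤n n≤m m≤Cn² with h , k , refl , nearly-equal ← halves n 2≤n =
  let (I , wf , conn , c≤2I , I≤ , slow) = hard-instance in
  I , wf , conn , ≤-scale K 2 (length I) m≤Kc c≤2I , few-edges I I≤ ,
  λ T found → ≤-scale K 3 T m≤Kc (slow T found)
  where
    open HardInstance A h k m (≤-trans (s≤s z≤n) n≤m) using (c; c≡; hard-instance)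
    K : ℕ
    K = suc (8 * C)
    m≤Kc : m ≤ K * c
    m≤Kc = subst (λ x → m ≤ K * x) (sym c≡) (enough-candidates C h k m nearly-equal m≤Cn²)
    few-edges : ∀ I → length I ≤ (h + k) + c → length I ≤ 2 * m
    few-edges I I≤ = begin
      length I      ≤⟨ I≤ ⟩
      (h + k) + c   ≤⟨ +-mono-≤ (≤-trans (+-mono-≤ (n≤1+n h) (n≤1+n k)) n≤m)
                                (subst (_≤ m) (sym c≡) (m⊓n≤m m _)) ⟩
      m + m         ≡⟨ cong (m +_) (+-identityʳ m) ⟨
      2 * m         ∎
      where open ≤-Reasoning

theorem3 : (C : ℕ) →
    Σ ℕ λ a → Σ ℕ λ b → Σ ℕ λ d →
      (A : OblivAlg) → FindsSpanningForests A →
      (n m : ℕ) → 2 ≤ n → n ≤ m → m ≤ C * (n * n) →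
      Σ (Instance n) λ I →
        WellFormed I × Connected (edgesOf I) ×
        (m ≤ a * length I) × (length I ≤ b * m) ×
        ((T : ℕ) → FoundBy A n I T → m ≤ d * T)
theorem3 C = suc (8 * C) * 2 , 2 , suc (8 * C) * 3 , λ A _ → lower-bound C A
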